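{- If $n$ is even, then whether a one-column two-color Clickomania puzzle with $n$ groups is solvable can be decided in time $O(n)$. If the puzzle is solvable, a solution can also be found in time $O(n)$.
   Context: A one-column two-color Clickomania puzzle is a finite word over a two-letter alphabet; its letters are called blocks. A group is a maximal run of consecutive equal letters; the puzzle is given by its groups $g_1,\dots,g_n$ in order (with their sizes). A move (click) deletes a group of size at least two from the current word; the remaining parts are then concatenated (so that the two neighbors of the deleted group, if there are two, merge into one group). A puzzle is solvable if some sequence of moves deletes all blocks; such a sequence is called a solution. In this setting a group with more than two blocks is equivalent to a group with just two blocks, so the problem can be reduced, in time linear in the number of blocks, to one of size linear in $n$; the time bounds refer to the reduced problem, in the usual unit-cost RAM model. -}

module Defs where

open import Data.Bool using (Bool; if_then_else_)
open import Data.Bool.Properties using () renaming (_≟_ to _≟ᵇ_)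
open import Data.List using (List; []; _∷_; _++_; _∷ʳ_; length; map; replicate; head; last; drop)
open import Data.Maybe using (Maybe; just; nothing)
open import Data.Nat using (ℕ; zero; suc; _+_; _∸_; _*_; _⊓_; _≤_; _≟_)
open import Data.Product using (_×_; _,_; proj₂; ∃-syntax)
open import Relation.Nullary using (¬_; does)
open import Relation.Binary.PropositionalEquality using (_≡_; _≢_)

Color : Set
Color = Bool

Puzzle : Set
Puzzle = List Color

pushBlock : Color → List (Color × ℕ) → List (Color × ℕ)
pushBlock b []             = (b , 1) ∷ []
pushBlock b ((c , k) ∷ gs) =
  if does (b ≟ᵇ c) then (c , suc k) ∷ gs else (b , 1) ∷ (c , k) ∷ gs

-- The maximal runs of equal letters, from left to right, each given by its
-- color and its size.
groups : Puzzle → List (Color × ℕ)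
groups []      = []
groups (b ∷ w) = pushBlock b (groups w)

numGroups : Puzzle → ℕ
numGroups w = length (groups w)

groupSizes : Puzzle → List ℕ
groupSizes w = map proj₂ (groups w)

-- w ⟶[ i ] w′ : clicking the i-th group of w (counted from 0, in the current
-- word) leaves w′.  The conditions on last u and head v say that the run
-- replicate k c is a maximal run; as u ends at a group boundary, exactly
-- numGroups u groups precede it.
data _⟶[_]_ : Puzzle → ℕ → Puzzle → Set where
  click : ∀ (u : Puzzle) (c : Color) (k : ℕ) (v : Puzzle) →
          last u ≢ just c → head v ≢ just c → 2 ≤ k →
          (u ++ replicate k c ++ v) ⟶[ numGroups u ] (u ++ v)

data Solution : Puzzle → List ℕ → Set where
  []  : Solution [] []
  _∷_ : ∀ {w w′ i is} → w ⟶[ i ] w′ → Solution w′ is → Solution w (i ∷ is)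

Solvable : Puzzle → Set
Solvable w = ∃[ is ] Solution w is

-- Unit-cost random access machine (Cook–Reckhow instruction set over ℕ,
-- with truncated subtraction).  There is one infinite array of registers,
-- a read-only input tape read from left to right, and a write-only output
-- tape.  In const, add, sub, load and read, the first argument is the
-- destination register.

Reg : Set
Reg = ℕ

data Instr : Set where
  const  : Reg → ℕ → Instr
  add    : Reg → Reg → Reg → Instr
  sub    : Reg → Reg → Reg → Instr
  load   : Reg → Reg → Instr
  store  : Reg → Reg → Instr
  jumpIf : Reg → ℕ → Instr
  read   : Reg → Instr
  print  : Reg → Instr
  halt   : Instr

Program : Set
Program = List Instr

Memory : Set
Memory = Reg → ℕ

_[_↦_] : Memory → Reg → ℕ → Memory
(m [ i ↦ x ]) j = if does (j ≟ i) then x else m j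

record Config : Set where
  constructor ⟨_,_,_,_⟩
  field
    pc     : ℕ
    mem    : Memory
    input  : List ℕ
    output : List ℕ

open Config public

initial : List ℕ → Config
initial xs = ⟨ 0 , (λ _ → 0) , xs , [] ⟩

fetch : Program → ℕ → Maybe Instr
fetch P l = head (drop l P)

-- nothing: the instruction has no successor configuration (it is halt, or it
-- reads past the end of the input).
exec : Instr → Config → Maybe Config
exec (const i n)  ⟨ p , m , xs , ys ⟩ = just ⟨ suc p , m [ i ↦ n ] , xs , ys ⟩
exec (add i j k)  ⟨ p , m , xs , ys ⟩ = just ⟨ suc p , m [ i ↦ m j + m k ] , xs , ys ⟩
exec (sub i j k)  ⟨ p , m , xs , ys ⟩ = just ⟨ suc p , m [ i ↦ m j ∸ m k ] , xs , ys ⟩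
exec (load i j)   ⟨ p , m , xs , ys ⟩ = just ⟨ suc p , m [ i ↦ m (m j) ] , xs , ys ⟩
exec (store i j)  ⟨ p , m , xs , ys ⟩ = just ⟨ suc p , m [ m i ↦ m j ] , xs , ys ⟩
exec (jumpIf i l) ⟨ p , m , xs , ys ⟩ with m i
... | zero  = just ⟨ suc p , m , xs , ys ⟩
... | suc _ = just ⟨ l , m , xs , ys ⟩
exec (read i)     ⟨ p , m , [] , ys ⟩     = nothing
exec (read i)     ⟨ p , m , x ∷ xs , ys ⟩ = just ⟨ suc p , m [ i ↦ x ] , xs , ys ⟩
exec (print i)    ⟨ p , m , xs , ys ⟩ = just ⟨ suc p , m , xs , ys ∷ʳ m i ⟩
exec halt         _                   = nothing

-- P ⊢ c ⇓ ys after t : started in c, the program P executes exactly t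
-- instructions, the last one being halt, and its output is then ys.
data _⊢_⇓_after_ (P : Program) : Config → List ℕ → ℕ → Set where
  stop : ∀ {c} → fetch P (pc c) ≡ just halt → P ⊢ c ⇓ output c after 1
  step : ∀ {c c′ I ys t} → fetch P (pc c) ≡ just I → exec I c ≡ just c′ →
         P ⊢ c′ ⇓ ys after t → P ⊢ c ⇓ ys after suc t

HaltsWithin : Program → List ℕ → ℕ → (List ℕ → Set) → Set
HaltsWithin P xs b Post =
  ∃[ ys ] ∃[ t ] (P ⊢ initial xs ⇓ ys after t × t ≤ b × Post ys)

_∈O_ : (ℕ → ℕ) → (ℕ → ℕ) → Set
T ∈O g = ∃[ c ] ∃[ n₀ ] (∀ n → n₀ ≤ n → T n ≤ c * g n)

-- The reduced problem: a group of more than two blocks is given to the machine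
-- as a group of two blocks.  A click of the i-th group is a legal move in a
-- puzzle iff it is one in its reduced form, so both have the same solutions.
-- The color of the first group is irrelevant and not part of the input.
encode : Puzzle → List ℕ
encode w = numGroups w ∷ map (2 ⊓_) (groupSizes w)

data Decides (A : Set) : List ℕ → Set where
  accept :   A → Decides A (1 ∷ [])
  reject : ¬ A → Decides A (0 ∷ [])

{-# OPTIONS --safe #-}
-- Put the n = 2m groups on a circle, and call a group big if it has at least two
-- blocks.  In a solvable puzzle no m consecutive groups of the circle are all single
-- blocks: each block of such a run vanishes together with a mate outside the run, and
-- as the mates do not cross, they form an alternating word of length m that is a
-- subsequence of the m remaining groups, but starts in the color opposite to theirs.
--
-- Conversely, let p be the first big group, x the last big one with x − p < m and y
-- the first one with y − p ≥ m.  If no run is too long, then y exists and y − x ≤ m.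
-- Put k = y − p − m.  A click inside the puzzle merges the two neighbors into a big
-- group, so one can click k times in the same place, starting with x.  This leaves
-- 2(m − k) groups, of which p and y − 2k are big and antipodal.  Thus the groups up
-- to 2p are centered at p and the later ones are centered at y − 2k, and each of these
-- two parts is cleared by clicking again and again at its center.
--
-- One scan of the input with a fixed number of registers finds p, x and y.
module Submission where

open import Defs
open import Data.Bool using (true; false; not)
open import Data.Bool.Properties using (not-involutive; not-¬; ¬-not) renaming (_≟_ to _≟ᵇ_)
open import Data.List using (List; []; _∷_; _++_; _∷ʳ_; length; replicate; reverse; last; head;
  map; drop; initLast; _∷ʳ′_)
open import Data.List.Properties using (∷-injective; ∷-injectiveˡ; ∷-injectiveʳ; ++-assoc; ++-identityʳ;
  length-++; length-replicate; length-reverse; length-map; reverse-++; unfold-reverse; drop-drop)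
open import Data.List.Relation.Binary.Sublist.Propositional using (_⊆_; []; _∷_; ⊆-refl; ⊆-trans; minimum)
  renaming (_∷ʳ_ to skip)
open import Data.List.Relation.Binary.Sublist.Propositional.Properties using (++⁺; ++⁺ˡ; length-mono-≤)
open import Data.List.Relation.Unary.All as All using (All; []; _∷_)
import Data.List.Relation.Unary.All.Properties as All
open import Data.List.Relation.Unary.Linked as Linked using (Linked; []; [-]; _∷_)
open import Data.Maybe using (Maybe; just; nothing)
open import Data.Nat
open import Data.Nat.Divisibility using (_∣_; divides)
open import Data.Nat.Properties
open import Data.Nat.Tactic.RingSolver using (solve-∀)
open import Data.Product using (_×_; _,_; ∃-syntax; proj₂)
open import Data.Product.Properties using (,-injectiveˡ)
open import Data.Unit using (⊤; tt)
open import Relation.Binary.PropositionalEquality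
open import Relation.Nullary using (¬_; contradiction; yes; no)

-- Mates in alternating words

Alternating : Puzzle → Set
Alternating = Linked _≢_

alternating-++⁻ˡ : ∀ u {v} → Alternating (u ++ v) → Alternating u
alternating-++⁻ˡ []          _         = []
alternating-++⁻ˡ (a ∷ [])    _         = [-]
alternating-++⁻ˡ (a ∷ b ∷ u) (a≢b ∷ l) = a≢b ∷ alternating-++⁻ˡ (b ∷ u) l

alternating-++⁻ʳ : ∀ u {v} → Alternating (u ++ v) → Alternating v
alternating-++⁻ʳ []      l = l
alternating-++⁻ʳ (a ∷ u) l = alternating-++⁻ʳ u (Linked.tail l)

no-repetition : ∀ u {c v} → ¬ Alternating (u ++ c ∷ c ∷ v)
no-repetition u l with alternating-++⁻ʳ u l
... | c≢c ∷ _ = c≢c refl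

-- A click with its index and the maximality of the run forgotten, so that it can be pushed under a
-- prefix block by block. `here` takes an equation so that it can be matched when the word is a
-- concatenation.
data Removal : Puzzle → Puzzle → Set where
  here  : ∀ {w c k v} → w ≡ c ∷ c ∷ replicate k c ++ v → Removal w v
  there : ∀ {a w w′} → Removal w w′ → Removal (a ∷ w) (a ∷ w′)

removal-++ : ∀ u {w w′} → Removal w w′ → Removal (u ++ w) (u ++ w′)
removal-++ []      r = r
removal-++ (a ∷ u) r = there (removal-++ u r)

removal-click : ∀ {w i w′} → w ⟶[ i ] w′ → Removal w w′
removal-click (click u c (suc (suc k)) v _ _ (s≤s (s≤s _))) =
  removal-++ u (here {k = k} refl)

removal-⊆ : ∀ {w w′} → Removal w w′ → w′ ⊆ w
removal-⊆ (here {c = c} {k} refl) = ++⁺ˡ (c ∷ c ∷ replicate k c) ⊆-refl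
removal-⊆ (there r)               = refl ∷ removal-⊆ r

alternating-stuck : ∀ {w w′} → Alternating w → ¬ Removal w w′
alternating-stuck l (here refl) = no-repetition [] l
alternating-stuck l (there r)   = alternating-stuck (Linked.tail l) r

-- A run that ends exactly at the cut counts as `inside`, so in `across` a block of the run always
-- stands right after the cut.
data RunSplit (c : Color) (k : ℕ) (v x y : Puzzle) : Set where
  inside : ∀ x₁ → x ≡ replicate k c ++ x₁ → v ≡ x₁ ++ y → RunSplit c k v x y
  across : ∀ i j → x ≡ replicate i c → y ≡ c ∷ replicate j c ++ v → RunSplit c k v x y

splitRun : ∀ {c v} k x {y} → x ++ y ≡ replicate k c ++ v → RunSplit c k v x y
splitRun zero    x        eq = inside x refl (sym eq)
splitRun (suc k) []       eq = across 0 k refl eq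
splitRun (suc k) (a ∷ x)  eq with ∷-injective eq
... | refl , eq′ with splitRun k x eq′
... | inside x₁ p q   = inside x₁ (cong (a ∷_) p) q
... | across i j p q  = across (suc i) j (cong (a ∷_) p) q

-- In `across`, `i` and `j` count the removed blocks beyond the two at the cut: zero means one block
-- on that side.
data RemovalSplit (x y w′ : Puzzle) : Set where
  left   : ∀ x′ → Removal x x′ → w′ ≡ x′ ++ y → RemovalSplit x y w′
  right  : ∀ y′ → Removal y y′ → w′ ≡ x ++ y′ → RemovalSplit x y w′
  across : ∀ x₁ c i j y₁ → x ≡ x₁ ++ c ∷ replicate i c → y ≡ c ∷ replicate j c ++ y₁ →
           w′ ≡ x₁ ++ y₁ → RemovalSplit x y w′

splitRemoval : ∀ x {y w′} → Removal (x ++ y) w′ → RemovalSplit x y w′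
splitRemoval []      r         = right _ r refl
splitRemoval (a ∷ x) (here {k = k} eq) with splitRun (2 + k) (a ∷ x) eq
... | inside x₁ p q        = left x₁ (here {k = k} p) q
... | across (suc i) j p q = across [] _ i j _ p q refl
splitRemoval (a ∷ x) (there r) with splitRemoval x r
... | left x′ r′ p            = left (a ∷ x′) (there r′) (cong (a ∷_) p)
... | right y′ r′ p           = right y′ r′ (cong (a ∷_) p)
... | across x₁ c i j y₁ p q s = across (a ∷ x₁) c i j y₁ (cong (a ∷_) p) q (cong (a ∷_) s)

reverse-∷ʳ : ∀ (u : Puzzle) c → reverse (u ∷ʳ c) ≡ c ∷ reverse u
reverse-∷ʳ u c = reverse-++ u (c ∷ [])

-- No two blocks of an alternating factor can vanish in the same click.  So each
-- has a mate of its own outside, and the mates of different blocks do not cross.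
mates-of-factor : ∀ {w is} u r v → Solution w is → w ≡ u ++ r ++ v → Alternating r →
                  reverse r ⊆ v ++ u
mates-of-factor [] []      v [] eq l = minimum _
mates-of-factor [] (_ ∷ _) v [] () l
mates-of-factor (_ ∷ _) r  v [] () l
mates-of-factor u r v (cl ∷ sol) refl l with splitRemoval u (removal-click cl)
... | left u′ d eq = ⊆-trans (mates-of-factor u′ r v sol eq l) (++⁺ (⊆-refl {x = v}) (removal-⊆ d))
mates-of-factor u r v (cl ∷ sol) refl l | right z d refl with splitRemoval r d
... | left r′ d′ _  = contradiction d′ (alternating-stuck l)
... | right v′ d′ eq = ⊆-trans (mates-of-factor u r v′ sol (cong (u ++_) eq) l) (++⁺ (removal-⊆ d′) ⊆-refl)
... | across r₁ c (suc i) j v₁ refl q eq = contradiction l (no-repetition r₁)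
-- The last block of the factor vanishes with the first of `v`, and these two stand first in
-- `reverse r` and in `v ++ u`.
... | across r₁ c zero j v₁ refl refl eq =
  subst (_⊆ _) (sym (reverse-∷ʳ r₁ c))
    (refl ∷ ⊆-trans (mates-of-factor u r₁ v₁ sol (cong (u ++_) eq) (alternating-++⁻ˡ r₁ l))
                    (++⁺ (++⁺ˡ (replicate j c) ⊆-refl) (⊆-refl {x = u})))
mates-of-factor u [] v (cl ∷ sol) refl l | across u₁ c i j z₁ p q eq = minimum _
-- The mirror case: the first block of the factor vanishes with the end of `u`. It comes last in the
-- reversed factor, and its mate comes after all of `v ++ u₁`.
mates-of-factor u (_ ∷ r) v (cl ∷ sol) refl l | across u₁ c i zero z₁ refl refl eq =
  subst₂ _⊆_ (sym (unfold-reverse c r)) (++-assoc v u₁ _)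
    (++⁺ (mates-of-factor u₁ r v sol eq (Linked.tail l)) (refl ∷ minimum _))
-- The run can pass beyond the first block of the factor only if there is no other; the mate is then
-- taken in `u`.
mates-of-factor u (_ ∷ []) v (cl ∷ sol) refl l | across u₁ c i (suc j) z₁ refl q eq
  with refl ← ∷-injectiveˡ q =
  ++⁺ˡ v (++⁺ˡ u₁ (refl ∷ minimum _))
mates-of-factor u (_ ∷ _ ∷ r) v (cl ∷ sol) refl (a≢b ∷ l) | across u₁ c i (suc j) z₁ p q eq
  with refl ← ∷-injectiveˡ q | refl ← ∷-injectiveˡ (∷-injectiveʳ q) =
  contradiction refl a≢b

-- On the circle `y ++ x` is a factor again, interrupted by the ends of the word. The induction on
-- the solution is as before; the new case is a run that reaches from `x` through all of `u` into
-- `y`.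
mates-across-ends : ∀ {w is} x u y → Solution w is → w ≡ x ++ u ++ y → Alternating (y ++ x) →
                    reverse (y ++ x) ⊆ u
mates-across-ends [] u [] [] eq l = minimum _
mates-across-ends (_ ∷ _) u y [] () l
mates-across-ends [] [] (_ ∷ _) [] () l
mates-across-ends [] (_ ∷ _) (_ ∷ _) [] () l
mates-across-ends x u y (cl ∷ sol) refl l with splitRemoval x (removal-click cl)
... | left x′ d eq = contradiction d (alternating-stuck (alternating-++⁻ʳ y l))
mates-across-ends x u y (cl ∷ sol) refl l | right z d refl with splitRemoval u d
... | left u′ d′ eq = ⊆-trans (mates-across-ends x u′ y sol (cong (x ++_) eq) l) (removal-⊆ d′)
... | right y′ d′ eq = contradiction d′ (alternating-stuck (alternating-++⁻ˡ y l))
... | across u₁ c i (suc j) y₁ p refl eq = contradiction l (no-repetition [])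
... | across u₁ c i zero y₁ refl refl eq =
  subst (_⊆ _) (sym (unfold-reverse c (y₁ ++ x)))
    (++⁺ (mates-across-ends x u₁ y₁ sol (cong (x ++_) eq) (Linked.tail l)) (refl ∷ minimum _))
mates-across-ends x u y (cl ∷ sol) refl l | across x₁ c (suc i) j z₁ refl q eq =
  contradiction (subst Alternating (sym (++-assoc y x₁ _)) l) (no-repetition (y ++ x₁))
mates-across-ends x u y (cl ∷ sol) refl l | across x₁ c zero j z₁ refl q eq
  with splitRun (suc j) u q
... | inside u₁ refl refl =
  subst (_⊆ _) (trans (sym (reverse-∷ʳ (y ++ x₁) c)) (cong reverse (++-assoc y x₁ _)))
    (refl ∷ ++⁺ˡ (replicate j c)
      (mates-across-ends x₁ u₁ y sol eq (alternating-++⁻ˡ (y ++ x₁) (subst Alternating (sym (++-assoc y x₁ _)) l))))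
... | across i (suc k) p refl = contradiction l (no-repetition [])
-- The click takes all of `u` and one block each of `x` and `y`. By induction the blocks of
-- `z₁ ++ x₁` have mates in the empty word, so there are none, and `y ++ x` consists of two equal
-- blocks.
... | across i zero p refl =
  contradiction (mates-across-ends x₁ [] z₁ sol eq (Linked.tail (alternating-++⁻ˡ (c ∷ z₁ ++ x₁) l′)))
                (unmatched l′)
  where
  l′ : Alternating (c ∷ (z₁ ++ x₁) ∷ʳ c)
  l′ = subst (λ v → Alternating (c ∷ v)) (sym (++-assoc z₁ x₁ _)) l
  unmatched : ∀ {v} → Alternating (c ∷ v ∷ʳ c) → ¬ reverse v ⊆ []
  unmatched {[]}    l = contradiction l (no-repetition [])
  unmatched {a ∷ v} l = λ τ →
    contradiction (subst (_≤ 0) (length-reverse (a ∷ v)) (length-mono-≤ τ)) λ ()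

-- Alternating subsequences and the lengths of runs of single groups

colorAfter : ℕ → Color → Color
colorAfter zero    c = c
colorAfter (suc l) c = colorAfter l (not c)

colorAfter-+ : ∀ a b c → colorAfter (a + b) c ≡ colorAfter b (colorAfter a c)
colorAfter-+ zero    b c = refl
colorAfter-+ (suc a) b c = colorAfter-+ a b (not c)

colorAfter-not : ∀ l c → colorAfter l (not c) ≡ not (colorAfter l c)
colorAfter-not zero    c = refl
colorAfter-not (suc l) c = colorAfter-not l (not c)

colorAfter-twice : ∀ l c → colorAfter l (colorAfter l c) ≡ c
colorAfter-twice zero    c = refl
colorAfter-twice (suc l) c = begin
  colorAfter l (not (colorAfter l (not c))) ≡⟨ colorAfter-not l _ ⟩
  not (colorAfter l (colorAfter l (not c))) ≡⟨ cong not (colorAfter-twice l (not c)) ⟩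
  not (not c)                               ≡⟨ not-involutive c ⟩
  c                                         ∎
  where open ≡-Reasoning

expand : Color → List ℕ → Puzzle
expand c []       = []
expand c (s ∷ ss) = replicate s c ++ expand (not c) ss

expand-++ : ∀ c ss ts → expand c (ss ++ ts) ≡ expand c ss ++ expand (colorAfter (length ss) c) ts
expand-++ c []       ts = refl
expand-++ c (s ∷ ss) ts =
  trans (cong (replicate s c ++_) (expand-++ (not c) ss ts)) (sym (++-assoc (replicate s c) _ _))

ones : ℕ → List ℕ
ones l = replicate l 1

alternation : Color → ℕ → Puzzle
alternation c l = expand c (ones l)

alternation-alternating : ∀ c l → Alternating (alternation c l)
alternation-alternating c zero          = []
alternation-alternating c (suc zero)    = [-]
alternation-alternating c (suc (suc l)) = not-¬ refl ∷ alternation-alternating (not c) (suc l)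

alternation-++ : ∀ c k l → alternation c (k + l) ≡ alternation c k ++ alternation (colorAfter k c) l
alternation-++ c zero    l = refl
alternation-++ c (suc k) l = cong (c ∷_) (alternation-++ (not c) k l)

reverse-alternation : ∀ c l → reverse (alternation c l) ≡ alternation (not (colorAfter l c)) l
reverse-alternation c zero    = refl
reverse-alternation c (suc l) = begin
  reverse (c ∷ alternation (not c) l)
    ≡⟨ unfold-reverse c (alternation (not c) l) ⟩
  reverse (alternation (not c) l) ∷ʳ c
    ≡⟨ cong₂ _∷ʳ_ (reverse-alternation (not c) l) (sym closing) ⟩
  alternation d l ++ alternation (colorAfter l d) 1
    ≡⟨ alternation-++ d l 1 ⟨
  alternation d (l + 1)
    ≡⟨ cong (alternation d) (+-comm l 1) ⟩
  alternation d (suc l)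
    ∎
  where
  open ≡-Reasoning
  d = not (colorAfter l (not c))
  closing : colorAfter l d ≡ c
  -- By definition, `colorAfter l d` is `colorAfter (suc l) (colorAfter (suc l) c)`.
  closing = colorAfter-twice (suc l) c

alternation-split : ∀ {c l} x {y} → alternation c l ⊆ x ++ y →
  ∃[ i ] ∃[ j ] (l ≡ i + j × alternation c i ⊆ x × alternation (colorAfter i c) j ⊆ y)
alternation-split []      τ = 0 , _ , refl , [] , τ
alternation-split {l = zero}  (a ∷ x) τ = 0 , 0 , refl , minimum _ , minimum _
alternation-split {l = suc l} (a ∷ x) (skip _ τ) with alternation-split {l = suc l} x τ
... | i , j , eq , τ₁ , τ₂ = i , j , eq , skip a τ₁ , τ₂
alternation-split {l = suc l} (a ∷ x) (refl ∷ τ) with alternation-split {l = l} x τ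
... | i , j , eq , τ₁ , τ₂ = suc i , j , cong suc eq , refl ∷ τ₁ , τ₂

-- Once a letter is matched in the group, the remaining word starts with the other color and finds
-- no letter there.
alternation-⊆-group : ∀ {c l} d s → alternation c l ⊆ replicate s d → l ≤ 1
alternation-⊈-group : ∀ {l} d s → alternation (not d) l ⊆ replicate s d → l ≤ 0

alternation-⊆-group {l = zero}  d s       τ          = z≤n
alternation-⊆-group {l = suc l} d (suc s) (skip _ τ) = alternation-⊆-group {l = suc l} d s τ
alternation-⊆-group {l = suc l} d (suc s) (refl ∷ τ) = s≤s (alternation-⊈-group {l} d s τ)

alternation-⊈-group {zero}  d s       τ          = z≤n
alternation-⊈-group {suc l} d (suc s) (skip _ τ) = alternation-⊈-group {suc l} d s τ
alternation-⊈-group {suc l} d (suc s) (eq ∷ τ)   = contradiction (sym eq) (not-¬ refl)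

alternation-⊆-expand : ∀ {c l} d ss → alternation c l ⊆ expand d ss → l ≤ length ss
alternation-⊆-expand {l = zero} d [] τ = z≤n
alternation-⊆-expand {c} {l} d (s ∷ ss) τ with alternation-split {c} {l} (replicate s d) τ
... | i , j , refl , τ₁ , τ₂ =
  +-mono-≤ (alternation-⊆-group {l = i} d s τ₁) (alternation-⊆-expand {l = j} (not d) ss τ₂)

-- Each group yields at most one letter, and the first group yields none, as its color is opposite
-- to that of the first letter.
alternation-⊆-expand′ : ∀ {l} d ss → alternation (not d) l ⊆ expand d ss → l ≤ length ss ∸ 1
alternation-⊆-expand′ {zero} d [] τ = z≤n
alternation-⊆-expand′ {l} d (s ∷ ss) τ with alternation-split {not d} {l} (replicate s d) τ
... | i , j , refl , τ₁ , τ₂ =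
  +-mono-≤ (alternation-⊈-group {i} d s τ₁) (alternation-⊆-expand {l = j} (not d) ss τ₂)

-- The mates of the run, read from its right neighbor on around the circle, start with the color of
-- the last block of the run. Group `s` has the opposite color and supplies no mate, which leaves
-- `vs` and `us`.
inner-gap-bound : ∀ {c is} us z s vs → Solution (expand c (us ++ ones z ++ s ∷ vs)) is →
                  z ≤ length vs + length us
inner-gap-bound {c} us z s vs sol with alternation-split {not e} {z} (expand e (s ∷ vs)) mates
  where
  d e : Color
  d = colorAfter (length us) c
  e = colorAfter z d
  word : expand c (us ++ ones z ++ s ∷ vs) ≡ expand c us ++ alternation d z ++ expand e (s ∷ vs)
  word = begin
    expand c (us ++ ones z ++ s ∷ vs)
      ≡⟨ expand-++ c us _ ⟩
    expand c us ++ expand d (ones z ++ s ∷ vs)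
      ≡⟨ cong (expand c us ++_) (expand-++ d (ones z) _) ⟩
    expand c us ++ alternation d z ++ expand (colorAfter (length (ones z)) d) (s ∷ vs)
      ≡⟨ cong (λ l → expand c us ++ alternation d z ++ expand (colorAfter l d) (s ∷ vs)) (length-replicate z) ⟩
    expand c us ++ alternation d z ++ expand e (s ∷ vs)
      ∎
    where open ≡-Reasoning
  mates : alternation (not e) z ⊆ expand e (s ∷ vs) ++ expand c us
  mates = subst (_⊆ expand e (s ∷ vs) ++ expand c us) (reverse-alternation d z)
    (mates-of-factor (expand c us) (alternation d z) _ sol word (alternation-alternating d z))
... | i , j , refl , τ₁ , τ₂ =
  +-mono-≤ (alternation-⊆-expand′ {i} _ (s ∷ vs) τ₁) (alternation-⊆-expand {l = j} c us τ₂)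

-- With an even number of groups the colors continue around the circle, so the last `z` and the
-- first `p` groups form one alternating run. Its mates lie in `ts` and start with the color
-- opposite to that of the first group there.
outer-gap-bound : ∀ {c is} m p ts z → p + (length ts + z) ≡ m + m →
                  Solution (expand c (ones p ++ ts ++ ones z)) is → z + p ≤ length ts ∸ 1
outer-gap-bound {c} m p ts z even sol = alternation-⊆-expand′ {z + p} d ts mates
  where
  open ≡-Reasoning
  d e : Color
  d = colorAfter p c
  e = colorAfter (length ts) d
  around : colorAfter z e ≡ c
  around = begin
    colorAfter z (colorAfter (length ts) d) ≡⟨ colorAfter-+ (length ts) z d ⟨
    colorAfter (length ts + z) d            ≡⟨ colorAfter-+ p (length ts + z) c ⟨
    colorAfter (p + (length ts + z)) c      ≡⟨ cong (λ l → colorAfter l c) even ⟩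
    colorAfter (m + m) c                    ≡⟨ colorAfter-+ m m c ⟩
    colorAfter m (colorAfter m c)           ≡⟨ colorAfter-twice m c ⟩
    c                                       ∎
  run : alternation e z ++ alternation c p ≡ alternation e (z + p)
  run = trans (cong (λ a → alternation e z ++ alternation a p) (sym around)) (sym (alternation-++ e z p))
  word : expand c (ones p ++ ts ++ ones z) ≡ alternation c p ++ expand d ts ++ alternation e z
  word = begin
    expand c (ones p ++ ts ++ ones z)
      ≡⟨ expand-++ c (ones p) _ ⟩
    alternation c p ++ expand (colorAfter (length (ones p)) c) (ts ++ ones z)
      ≡⟨ cong (λ l → alternation c p ++ expand (colorAfter l c) (ts ++ ones z)) (length-replicate p) ⟩
    alternation c p ++ expand d (ts ++ ones z)
      ≡⟨ cong (alternation c p ++_) (expand-++ d ts _) ⟩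
    alternation c p ++ expand d ts ++ alternation e z
      ∎
  reversed : reverse (alternation e z ++ alternation c p) ≡ alternation (not d) (z + p)
  reversed = begin
    reverse (alternation e z ++ alternation c p)   ≡⟨ cong reverse run ⟩
    reverse (alternation e (z + p))                ≡⟨ reverse-alternation e (z + p) ⟩
    alternation (not (colorAfter (z + p) e)) (z + p)
      ≡⟨ cong (λ a → alternation (not a) (z + p)) (trans (colorAfter-+ z p e) (cong (colorAfter p) around)) ⟩
    alternation (not d) (z + p)                    ∎
  mates : alternation (not d) (z + p) ⊆ expand d ts
  mates = subst (_⊆ expand d ts) reversed
    (mates-across-ends (alternation c p) (expand d ts) (alternation e z) sol word
      (subst Alternating (sym run) (alternation-alternating e (z + p))))

-- Clicks on lists of group sizes

Positive : List ℕ → Set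
Positive = All (1 ≤_)

coloring : Color → List ℕ → List (Color × ℕ)
coloring c []       = []
coloring c (s ∷ ss) = (c , s) ∷ coloring (not c) ss

length-coloring : ∀ c ss → length (coloring c ss) ≡ length ss
length-coloring c []       = refl
length-coloring c (s ∷ ss) = cong suc (length-coloring (not c) ss)

pushBlock-new : ∀ c ss → pushBlock c (coloring (not c) ss) ≡ (c , 1) ∷ coloring (not c) ss
pushBlock-new c     []       = refl
pushBlock-new false (s ∷ ss) = refl
pushBlock-new true  (s ∷ ss) = refl

pushBlock-old : ∀ c k gs → pushBlock c ((c , k) ∷ gs) ≡ (c , suc k) ∷ gs
pushBlock-old false k gs = refl
pushBlock-old true  k gs = refl

groups-expand : ∀ c ss → Positive ss → groups (expand c ss) ≡ coloring c ss
groups-expand c []           []       = refl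
groups-expand c (suc s ∷ ss) (_ ∷ ps) = run s
  where
  run : ∀ s → groups (replicate (suc s) c ++ expand (not c) ss) ≡ (c , suc s) ∷ coloring (not c) ss
  run zero    = trans (cong (pushBlock c) (groups-expand (not c) ss ps)) (pushBlock-new c ss)
  run (suc s) = trans (cong (pushBlock c) (run s)) (pushBlock-old c (suc s) _)

numGroups-expand : ∀ c ss → Positive ss → numGroups (expand c ss) ≡ length ss
numGroups-expand c ss ps = trans (cong length (groups-expand c ss ps)) (length-coloring c ss)

-- Adjacent groups differ in color, and with only two colors the first color and the sizes then
-- determine the word.
as-expansion : ∀ w → ∃[ c ] (w ≡ expand c (groupSizes w) × groups w ≡ coloring c (groupSizes w)
                             × Positive (groupSizes w))
as-expansion []      = true , refl , refl , []
as-expansion (b ∷ w) with groups w | as-expansion w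
... | []     | c , eq , _ , _ = b , cong (b ∷_) eq , refl , ≤-refl ∷ []
... | (c , k) ∷ gs | c′ , eq , gr , p ∷ ps with refl ← ,-injectiveˡ (∷-injectiveˡ gr) | b ≟ᵇ c
... | yes refl = c , cong (c ∷_) eq , cong (λ hs → (c , suc k) ∷ hs) (∷-injectiveʳ gr) , s≤s z≤n ∷ ps
... | no b≢c with refl ← ¬-not (λ c≡b → b≢c (sym c≡b)) =
  b , cong (b ∷_) eq , cong ((b , 1) ∷_) gr , ≤-refl ∷ p ∷ ps

replicate-+ : ∀ a b (c : Color) → replicate (a + b) c ≡ replicate a c ++ replicate b c
replicate-+ zero    b c = refl
replicate-+ (suc a) b c = cong (c ∷_) (replicate-+ a b c)

last-++ : ∀ (u : Puzzle) c v → last (u ++ c ∷ v) ≡ last (c ∷ v)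
last-++ []          c v = refl
last-++ (a ∷ [])    c v = refl
last-++ (a ∷ b ∷ u) c v = last-++ (b ∷ u) c v

last-replicate : ∀ s (c : Color) → last (replicate (suc s) c) ≡ just c
last-replicate zero    c = refl
last-replicate (suc s) c = last-replicate s c

just≢ : ∀ {c} → just c ≢ just (not c)
just≢ {true} ()
just≢ {false} ()

last-expand : ∀ c ss → Positive ss → last (expand c ss) ≢ just (colorAfter (length ss) c)
last-expand c []                    _              ()
last-expand c (suc s ∷ [])          _              eq =
  just≢ (trans (sym (last-replicate s c)) (trans (cong last (sym (++-identityʳ (replicate (suc s) c)))) eq))
last-expand c (suc s ∷ suc t ∷ ss)  (_ ∷ ps@(s≤s _ ∷ _)) eq =
  last-expand (not c) (suc t ∷ ss) ps (trans (sym (last-++ (replicate (suc s) c) (not c) _)) eq)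

head-expand : ∀ c ss → Positive ss → head (expand (not c) ss) ≢ just c
head-expand c []           _ ()
head-expand true  (suc s ∷ ss) (s≤s _ ∷ _) ()
head-expand false (suc s ∷ ss) (s≤s _ ∷ _) ()

-- Positivity gives maximality of the run: as no group is empty, the blocks next to the run really
-- have the other color.
click-group : ∀ c us {s} vs → 2 ≤ s → Positive (us ++ s ∷ vs) →
  expand c (us ++ s ∷ vs) ⟶[ length us ] (expand c us ++ expand (not (colorAfter (length us) c)) vs)
click-group c us {s} vs 2≤s ps =
  subst₂ (λ w i → w ⟶[ i ] (expand c us ++ expand (not (colorAfter (length us) c)) vs))
    (sym (expand-++ c us (s ∷ vs))) (numGroups-expand c us pus)
    (click (expand c us) _ s _ (last-expand c us pus) (head-expand _ vs pvs) 2≤s)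
  where
  pus = All.++⁻ˡ us ps
  pvs = All.tail (All.++⁻ʳ us ps)

merge-word : ∀ c us a b vs →
  expand c (us ∷ʳ a) ++ expand (not (colorAfter (length (us ∷ʳ a)) c)) (b ∷ vs) ≡
  expand c (us ++ (a + b) ∷ vs)
merge-word c us a b vs = begin
  expand c (us ∷ʳ a) ++ expand (not (colorAfter (length (us ∷ʳ a)) c)) (b ∷ vs)
    ≡⟨ cong₂ (λ w e → w ++ expand e (b ∷ vs)) (expand-++ c us (a ∷ [])) color ⟩
  (expand c us ++ replicate a d ++ []) ++ expand d (b ∷ vs)
    ≡⟨ ++-assoc (expand c us) _ _ ⟩
  expand c us ++ (replicate a d ++ []) ++ expand d (b ∷ vs)
    ≡⟨ cong (λ w → expand c us ++ w ++ expand d (b ∷ vs)) (++-identityʳ (replicate a d)) ⟩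
  expand c us ++ replicate a d ++ replicate b d ++ expand (not d) vs
    ≡⟨ cong (expand c us ++_) (++-assoc (replicate a d) _ _) ⟨
  expand c us ++ (replicate a d ++ replicate b d) ++ expand (not d) vs
    ≡⟨ cong (λ w → expand c us ++ w ++ expand (not d) vs) (replicate-+ a b d) ⟨
  expand c us ++ expand d ((a + b) ∷ vs)
    ≡⟨ expand-++ c us _ ⟨
  expand c (us ++ (a + b) ∷ vs)
    ∎
  where
  open ≡-Reasoning
  d = colorAfter (length us) c
  color : not (colorAfter (length (us ∷ʳ a)) c) ≡ d
  color = begin
    not (colorAfter (length (us ∷ʳ a)) c) ≡⟨ cong (λ l → not (colorAfter l c)) (length-++ us) ⟩
    not (colorAfter (length us + 1) c)    ≡⟨ cong not (colorAfter-+ (length us) 1 c) ⟩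
    not (not d)                           ≡⟨ not-involutive d ⟩
    d                                     ∎

-- Repeated clicks in one place

data Big : List ℕ → ℕ → Set where
  here  : ∀ {s ss} → 2 ≤ s → Big (s ∷ ss) 0
  there : ∀ {s ss j} → Big ss j → Big (s ∷ ss) (suc j)

big-++ : ∀ us {s vs} → 2 ≤ s → Big (us ++ s ∷ vs) (length us)
big-++ []       2≤s = here 2≤s
big-++ (u ∷ us) 2≤s = there (big-++ us 2≤s)

big-view : ∀ {ss j} → Big ss j → ∃[ us ] ∃[ s ] ∃[ vs ] (ss ≡ us ++ s ∷ vs × length us ≡ j × 2 ≤ s)
big-view (here 2≤s) = [] , _ , _ , refl , refl , 2≤s
big-view (there {s = u} b) with big-view b
... | us , s , vs , refl , refl , 2≤s = u ∷ us , s , vs , refl , refl , 2≤s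

-- A click that merges its two neighbors leaves the merged group one index further left, so repeated
-- clicks in one place have indices that decrease by one.
countdown : ℕ → ℕ → List ℕ
countdown zero    v = []
countdown (suc k) v = v ∷ countdown k (v ∸ 1)

-- The effect of `k` clicks in one place, with the merged group ending at index `i`: indices up to
-- `i` persist, and those from `2k + i` on drop by `2k`.
record Contraction (c : Color) (ss : List ℕ) (i k : ℕ) (is : List ℕ) : Set where
  field
    ss′      : List ℕ
    positive : Positive ss′
    size     : k + k + length ss′ ≡ length ss
    centre   : Big ss′ i
    below    : ∀ {j} → j ≤ i → Big ss j → Big ss′ j
    above    : ∀ {j} → i ≤ j → Big ss (k + k + j) → Big ss′ j
    solve    : ∀ {js} → Solution (expand c ss′) js → Solution (expand c ss) (is ++ js)

merge-below : ∀ us {a b vs ws j} → 1 ≤ a → 1 ≤ b → j ≤ length us →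
              Big (us ++ a ∷ ws) j → Big (us ++ (a + b) ∷ vs) j
merge-below []       1≤a 1≤b z≤n       _         = here (+-mono-≤ 1≤a 1≤b)
merge-below (u ∷ us) 1≤a 1≤b _         (here p)  = here p
merge-below (u ∷ us) 1≤a 1≤b (s≤s j≤)  (there p) = there (merge-below us 1≤a 1≤b j≤ p)

merge-above : ∀ us {a s b vs j} → 1 ≤ a → 1 ≤ b → length us ≤ j →
              Big (us ++ a ∷ s ∷ b ∷ vs) (2 + j) → Big (us ++ (a + b) ∷ vs) j
merge-above []       {j = zero}  1≤a 1≤b _ _                         = here (+-mono-≤ 1≤a 1≤b)
merge-above []       {j = suc j} 1≤a 1≤b _ (there (there (there p))) = there p
merge-above (u ∷ us) 1≤a 1≤b (s≤s us≤j) (there p) = there (merge-above us 1≤a 1≤b us≤j p)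

merge-step : ∀ c {ss} i → Positive ss → Big ss (suc i) → 2 + i < length ss →
             Contraction c ss i 1 (suc i ∷ [])
merge-step c {ss} i ps big i< with big-view big
... | ts , s , vs₀ , refl , len , 2≤s with initLast ts
... | [] = contradiction len λ ()
... | us ∷ʳ′ a with vs₀
... | [] = contradiction i< (≤⇒≯ (≤-reflexive (trans (length-++ (us ∷ʳ a)) (trans (cong (_+ 1) len) (+-comm (suc i) 1)))))
... | b ∷ vs = record
  { ss′      = us ++ (a + b) ∷ vs
  ; positive = All.++⁺ pus (≤-trans pa (m≤m+n a b) ∷ pvs)
  ; size     = size
  ; centre   = subst (Big _) us≡i (big-++ us (+-mono-≤ pa pb))
  ; below    = λ j≤i p → merge-below us pa pb (≤-trans j≤i (≤-reflexive (sym us≡i))) (subst (λ l → Big l _) assoc p)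
  ; above    = λ i≤j p → merge-above us pa pb (≤-trans (≤-reflexive us≡i) i≤j) (subst (λ l → Big l _) assoc p)
  ; solve    = λ sol → subst₂ (λ j w → expand c ((us ∷ʳ a) ++ s ∷ b ∷ vs) ⟶[ j ] w) len (merge-word c us a b vs)
                         (click-group c (us ∷ʳ a) (b ∷ vs) 2≤s ps) ∷ sol
  }
  where
  assoc : (us ∷ʳ a) ++ s ∷ b ∷ vs ≡ us ++ a ∷ s ∷ b ∷ vs
  assoc = ++-assoc us (a ∷ []) _
  us≡i : length us ≡ i
  us≡i = suc-injective (trans (sym (trans (length-++ us) (+-comm (length us) 1))) len)
  ps′ : Positive (us ++ a ∷ s ∷ b ∷ vs)
  ps′ = subst Positive assoc ps
  pus = All.++⁻ˡ us ps′
  pa = All.head (All.++⁻ʳ us ps′)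
  pb = All.head (All.tail (All.tail (All.++⁻ʳ us ps′)))
  pvs = All.tail (All.tail (All.tail (All.++⁻ʳ us ps′)))
  size : 2 + length (us ++ (a + b) ∷ vs) ≡ length ((us ∷ʳ a) ++ s ∷ b ∷ vs)
  size = begin
    2 + length (us ++ (a + b) ∷ vs)        ≡⟨ cong (2 +_) (length-++ us) ⟩
    2 + (length us + suc (length vs))      ≡⟨ +-comm 2 (length us + suc (length vs)) ⟩
    length us + suc (length vs) + 2        ≡⟨ +-assoc (length us) _ 2 ⟩
    length us + (suc (length vs) + 2)      ≡⟨ cong (length us +_) (+-comm (suc (length vs)) 2) ⟩
    length us + (3 + length vs)            ≡⟨ length-++ us ⟨
    length (us ++ a ∷ s ∷ b ∷ vs)          ≡⟨ cong length assoc ⟨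
    length ((us ∷ʳ a) ++ s ∷ b ∷ vs)       ∎
    where open ≡-Reasoning

-- Each merged group is big, which allows the next click. The clicks use up `k` groups on either
-- side of index `k + i`: the form of the index provides them on the left, the bound on the length
-- on the right.
contract : ∀ c k i {ss} → Positive ss → Big ss (k + i) → k + (k + i) < length ss →
           Contraction c ss i k (countdown k (k + i))
contract c zero i {ss} ps big _ = record
  { ss′ = ss ; positive = ps ; size = refl ; centre = big
  ; below = λ _ b → b ; above = λ _ b → b ; solve = λ sol → sol }
contract c (suc k) i {ss} ps big k<
  with merge-step c (k + i) ps big (≤-<-trans (s≤s (m≤n+m (suc (k + i)) k)) k<)
... | s with contract c k i (Contraction.positive s) (Contraction.centre s)
               (≤-pred (≤-pred (≤-trans (≤-reflexive (cong (2 +_) (sym (+-suc k (k + i)))))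
                                         (≤-trans k< (≤-reflexive (sym (Contraction.size s)))))))
... | r = record
  { ss′      = R.ss′
  ; positive = R.positive
  ; size     = trans (cong (_+ length R.ss′) (cong suc (+-suc k k))) (trans (cong (2 +_) R.size) S.size)
  ; centre   = R.centre
  ; below    = λ j≤i b → R.below j≤i (S.below (≤-trans j≤i (m≤n+m i k)) b)
  ; above    = λ {j} i≤j b → R.above i≤j
                 (S.above (≤-trans (+-monoʳ-≤ k (≤-trans i≤j (m≤n+m j k))) (≤-reflexive (sym (+-assoc k k j))))
                          (subst (Big ss) (cong (_+ j) (cong suc (+-suc k k))) b))
  ; solve    = λ sol → S.solve (R.solve sol)
  }
  where
  module S = Contraction s
  module R = Contraction r

record Clearing (c : Color) (ss : List ℕ) (q : ℕ) (is : List ℕ) : Set where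
  field
    ss′      : List ℕ
    positive : Positive ss′
    size     : length ss′ ≡ q
    below    : ∀ {j} → j < q → Big ss j → Big ss′ j
    solve    : ∀ {js} → Solution (expand c ss′) js → Solution (expand c ss) (is ++ js)

big-prefix : ∀ us {vs j} → j < length us → Big (us ++ vs) j → Big us j
big-prefix (u ∷ us) _        (here p)  = here p
big-prefix (u ∷ us) (s≤s j<) (there b) = there (big-prefix us j< b)

clear-last : ∀ c q {ss} → Positive ss → Big ss q → length ss ≡ suc q → Clearing c ss q (q ∷ [])
clear-last c q ps big len with big-view big
... | us , s , [] , refl , us≡q , 2≤s = record
  { ss′      = us
  ; positive = All.++⁻ˡ us ps
  ; size     = us≡q
  ; below    = λ j<q → big-prefix us (≤-trans j<q (≤-reflexive (sym us≡q)))
  ; solve    = λ sol → subst₂ (λ j w → expand c (us ++ s ∷ []) ⟶[ j ] w) us≡q (++-identityʳ _)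
                         (click-group c us [] 2≤s ps) ∷ sol
  }
... | us , s , v ∷ vs , refl , refl , 2≤s =
  contradiction (trans (sym (length-++ us)) (trans len (sym (+-comm (length us) 1)))) λ eq →
    contradiction (+-cancelˡ-≡ (length us) _ _ eq) λ ()

-- Group `j + q` is the center of the last `2j + 1` groups. After `j` merges it is the last group,
-- at index `q`, and one more click deletes it without a merge.
clear-suffix : ∀ c j q {ss} → Positive ss → Big ss (j + q) → length ss ≡ suc (j + (j + q)) →
               Clearing c ss q (countdown (suc j) (j + q))
clear-suffix c zero    q ps big len = clear-last c q ps big len
clear-suffix c (suc j) q {ss} ps big len
  with merge-step c (j + q) ps big
         (≤-trans (s≤s (s≤s (m≤n+m (suc (j + q)) j))) (≤-reflexive (sym len)))
... | s with clear-suffix c j q (Contraction.positive s) (Contraction.centre s)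
               (suc-injective (suc-injective (trans (Contraction.size s) (trans len (cong (λ l → suc (suc l)) (+-suc j (j + q)))))))
... | r = record
  { ss′      = R.ss′
  ; positive = R.positive
  ; size     = R.size
  ; below    = λ j<q b → R.below j<q (S.below (≤-trans (<⇒≤ j<q) (m≤n+m q j)) b)
  ; solve    = λ sol → S.solve (R.solve sol)
  }
  where
  module S = Contraction s
  module R = Clearing r

-- For `m = p + k + r + 1`, `x = k + i` and `y = 2k + r + 2p + 1`: first the merges starting at `x`,
-- then the clearing of the last `2r + 1` groups, then that of the first `2p + 1`.
clicks : ℕ → ℕ → ℕ → ℕ → List ℕ
clicks p k r i = countdown k (k + i) ++ countdown (suc r) (r + suc (p + p)) ++ countdown (suc p) p

empty-solved : ∀ c ss → length ss ≡ 0 → Solution (expand c ss) []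
empty-solved c [] _ = []

clicks-solve : ∀ c p k r i {ss} → Positive ss → length ss ≡ (p + k + suc r) + (p + k + suc r) →
  Big ss p → Big ss (k + i) → Big ss (k + k + (r + suc (p + p))) →
  p ≤ i → i ≤ r + suc (p + p) → Solution (expand c ss) (clicks p k r i)
clicks-solve c p k r i {ss} ps len bp bx by p≤i i≤ =
  subst (Solution (expand c ss))
        (cong (λ is → countdown k (k + i) ++ countdown (suc r) (r + suc (p + p)) ++ is)
              (trans (++-identityʳ _) (cong (countdown (suc p)) (+-identityʳ p))))
        (A.solve (B.solve (C.solve (empty-solved c C.ss′ C.size))))
  where
  k< : k + (k + i) < length ss
  k< = begin-strict
    k + (k + i)                           ≡⟨ +-assoc k k i ⟨
    k + k + i                             ≤⟨ +-monoʳ-≤ (k + k) i≤ ⟩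
    k + k + (r + suc (p + p))             <⟨ s≤s (m≤n+m _ r) ⟩
    suc (r + (k + k + (r + suc (p + p)))) ≡⟨ arith k r p ⟩
    (p + k + suc r) + (p + k + suc r)     ≡⟨ len ⟨
    length ss                             ∎
    where
    open ≤-Reasoning
    arith : ∀ k r p → suc (r + (k + k + (r + suc (p + p)))) ≡ (p + k + suc r) + (p + k + suc r)
    arith = solve-∀
  module A = Contraction (contract c k i ps bx k<)
  size : length A.ss′ ≡ suc (r + (r + suc (p + p)))
  size = +-cancelˡ-≡ (k + k) _ _ (trans A.size (trans len (arith k r p)))
    where
    arith : ∀ k r p → (p + k + suc r) + (p + k + suc r) ≡ k + k + suc (r + (r + suc (p + p)))
    arith = solve-∀
  -- After the merges `2p + 2r + 2` groups are left. `i≤` lets `y` survive as the center of the last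
  -- `2r + 1` of them, and `p≤i` lets `p` survive as the center of the first `2p + 1`.
  module B = Clearing (clear-suffix c r (suc (p + p)) A.positive (A.above i≤ by) size)
  module C = Clearing (clear-suffix c p 0 B.positive
    (subst (Big B.ss′) (sym (+-identityʳ p)) (B.below (s≤s (m≤m+n p p)) (A.below p≤i bp)))
    (trans B.size (cong (λ l → suc (p + l)) (sym (+-identityʳ p)))))

-- The machine

Halts : Program → Config → ℕ → (List ℕ → Set) → Set
Halts P c b Post = ∃[ ys ] ∃[ t ] (P ⊢ c ⇓ ys after t × t ≤ b × Post ys)

weaken : ∀ {P c b b′ Post} → b ≤ b′ → Halts P c b Post → Halts P c b′ Post
weaken b≤b′ (ys , t , d , t≤b , post) = ys , t , d , ≤-trans t≤b b≤b′ , post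

halted : ∀ {P c b Post} → fetch P (pc c) ≡ just halt → Post (output c) → Halts P c (suc b) Post
halted f post = _ , 1 , stop f , s≤s z≤n , post

advance : ∀ {P c c′ I b Post} → fetch P (pc c) ≡ just I → exec I c ≡ just c′ →
          Halts P c′ b Post → Halts P c (suc b) Post
advance f e (ys , t , d , t≤b , post) = ys , suc t , step f e d , s≤s t≤b , post

-- Makes straight-line code, including `goto`, execute by computation: in `steps` the equation is
-- proved by `refl`. Jumps on an unknown register value are left to the two jump lemmas.
run : Program → ℕ → Config → Maybe Config
run P zero    c = just c
run P (suc k) c with fetch P (pc c)
... | nothing = nothing
... | just I with exec I c
...   | nothing = nothing
...   | just c′ = run P k c′

steps : ∀ {P} k {c c′ b Post} → run P k c ≡ just c′ → Halts P c′ b Post → Halts P c (k + b) Post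
steps zero refl h = h
steps {P} (suc k) {c} r h with fetch P (pc c) in f
... | just I with exec I c in e
...   | just c′ = advance f e (steps k r h)

jump-taken : ∀ {P p m xs ys i l v b Post} → fetch P p ≡ just (jumpIf i l) → m i ≡ suc v →
             Halts P ⟨ l , m , xs , ys ⟩ b Post → Halts P ⟨ p , m , xs , ys ⟩ (suc b) Post
jump-taken {m = m} {xs} {ys} {i} {l} f eq = advance f (taken eq)
  where
  taken : ∀ {v p} → m i ≡ suc v → exec (jumpIf i l) ⟨ p , m , xs , ys ⟩ ≡ just ⟨ l , m , xs , ys ⟩
  taken eq rewrite eq = refl

jump-skipped : ∀ {P p m xs ys i l b Post} → fetch P p ≡ just (jumpIf i l) → m i ≡ 0 →
               Halts P ⟨ suc p , m , xs , ys ⟩ b Post → Halts P ⟨ p , m , xs , ys ⟩ (suc b) Post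
jump-skipped {m = m} {xs} {ys} {i} {l} f eq = advance f (skipped eq)
  where
  skipped : ∀ {p} → m i ≡ 0 → exec (jumpIf i l) ⟨ p , m , xs , ys ⟩ ≡ just ⟨ suc p , m , xs , ys ⟩
  skipped eq rewrite eq = refl

pattern #n    = 0
pattern #i    = 1
pattern #p    = 2
pattern #x    = 3
pattern #zero = 4
pattern #one  = 5
pattern #d    = 6
pattern #t    = 7
pattern #b    = 8
pattern #v    = 9
pattern #k    = 10

goto : ℕ → Program
goto l = const #t 1 ∷ jumpIf #t l ∷ []

-- The numbers in comments are the addresses of the instructions below them.
scan : Program
scan =
  -- 0
  read #n ∷ const #one 1 ∷ jumpIf #n 5 ∷ goto 35 ++
  -- 5: search for p
  sub #t #n #i ∷ jumpIf #t 9 ∷ print #zero ∷ halt ∷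
  -- 9
  read #b ∷ sub #b #b #one ∷ jumpIf #b 15 ∷ add #i #i #one ∷ goto 5 ++
  -- 15
  add #p #i #zero ∷
  -- 16
  add #x #i #zero ∷
  -- 17: search for y
  add #i #i #one ∷ sub #t #n #i ∷ jumpIf #t 22 ∷
  -- 20
  print #zero ∷ halt ∷
  -- 22
  read #b ∷ sub #b #b #one ∷ jumpIf #b 27 ∷ goto 17 ++
  -- 27
  sub #t #i #p ∷ add #t #t #t ∷ sub #t #n #t ∷ jumpIf #t 16 ∷
  -- 31
  sub #t #i #x ∷ add #t #t #t ∷ sub #t #t #n ∷ jumpIf #t 20 ∷ []

-- `#k` holds twice the number of clicks still to be printed and drops by two per round, because the
-- first count is only available as `2(y − p) − n = 2k`.
countdownLoop : ℕ → Program
countdownLoop l =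
  jumpIf #k (3 + l) ∷ goto (9 + l) ++
  print #v ∷ sub #v #v #one ∷ sub #k #k #one ∷ sub #k #k #one ∷ goto l

decider : Program
decider = scan ++ const #t 1 ∷ print #t ∷ halt ∷ []

solver : Program
solver = scan ++
  -- 35
  jumpIf #n 37 ∷ halt ∷
  -- 37
  add #d #p #p ∷ add #k #i #i ∷ sub #k #k #d ∷ sub #k #k #n ∷ add #v #x #zero ∷
  countdownLoop 42 ++
  -- 51
  add #v #n #d ∷ sub #v #v #i ∷ sub #k #v #d ∷ add #k #k #k ∷
  countdownLoop 55 ++
  -- 64
  add #v #p #zero ∷ add #k #d #one ∷ add #k #k #one ∷
  countdownLoop 67 ++
  -- 76
  halt ∷ []

-- The loop writes only to `#t`, `#v` and `#k`, all numbered 7 or higher, so an invariant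
-- insensitive to those registers survives. A round takes 7 instructions and the exit takes 3.
countdown-loop : ∀ {P Post} l rest → drop l P ≡ countdownLoop l ++ rest →
  (Inv : Memory → Set) → (∀ m → Inv m → m #one ≡ 1) →
  (∀ m r {v} → Inv m → Inv (m [ 7 + r ↦ v ])) →
  ∀ k {v m xs ys b} → Inv m → m #v ≡ v → m #k ≡ k + k →
  (∀ {m} → Inv m → Halts P ⟨ 9 + l , m , xs , ys ++ countdown k v ⟩ b Post) →
  Halts P ⟨ l , m , xs , ys ⟩ (k * 7 + (3 + b)) Post
countdown-loop {P} {Post} l rest code Inv one frame = loop
  where
  -- As the address `l` is a variable, fetching does not compute; each instruction is obtained from
  -- `code` instead.
  at : ∀ j → fetch P (j + l) ≡ fetch (countdownLoop l ++ rest) j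
  at j = trans (cong (λ i → fetch P i) (+-comm j l))
    (cong head (trans (sym (drop-drop l j P)) (cong (drop j) code)))
  loop : ∀ k {v m xs ys b} → Inv m → m #v ≡ v → m #k ≡ k + k →
    (∀ {m} → Inv m → Halts P ⟨ 9 + l , m , xs , ys ++ countdown k v ⟩ b Post) →
    Halts P ⟨ l , m , xs , ys ⟩ (k * 7 + (3 + b)) Post
  loop zero {xs = xs} {ys} {b} inv hv hk next =
    jump-skipped (at 0) hk (advance (at 1) refl (advance (at 2) refl
      (subst (λ ys → Halts P ⟨ 9 + l , _ , xs , ys ⟩ b Post) (++-identityʳ ys) (next (frame _ 0 inv)))))
  loop (suc k) {v} {m} {xs} {ys} {b} inv hv hk next =
    jump-taken (at 0) hk (advance (at 3) refl (advance (at 4) refl (advance (at 5) refl (advance (at 6) refl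
      (advance (at 7) refl (advance (at 8) refl
      (loop k (frame _ 0 (frame _ 3 (frame _ 3 (frame _ 2 inv))))
        (cong₂ _∸_ hv (one _ inv))
        (trans (cong₂ (λ a b → a ∸ b ∸ b) hk (one _ inv)) (cong (_∸ 1) (+-suc k k)))
        λ {m′} inv′ → subst (λ ys → Halts P ⟨ 9 + l , m′ , xs , ys ⟩ b Post)
          (sym (trans (++-assoc ys (m #v ∷ []) _) (cong (λ a → ys ++ a ∷ countdown k (v ∸ 1)) hv))) (next inv′))))))))

-- Outcomes of the scan

big-length : ∀ {ss j} → Big ss j → j < length ss
big-length (here _)  = s≤s z≤n
big-length (there b) = s≤s (big-length b)

halve-≤ : ∀ {a b} → a + a ≤ b + b → a ≤ b
halve-≤ h = ≮⇒≥ λ b<a → <⇒≱ (+-mono-< b<a b<a) h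

halve-< : ∀ {a b} → a + a < b + b → a < b
halve-< h = ≰⇒> λ b≤a → <⇒≱ h (+-mono-≤ b≤a b≤a)

-- For an even length, either case means that at least half of the circle is a run of single groups.
-- In `outer` it goes around the end, and `ts` extends from `p` to `x`, or is empty if no group is
-- big; the `suc` arises from `length ts = x − p + 1`. In `inner` it lies between `x` and `y`, with
-- `suc z = y − x`.
data Failure (ss : List ℕ) : Set where
  outer : ∀ p ts z → ss ≡ ones p ++ ts ++ ones z → 0 < length ss →
          length ts + length ts ≤ suc (length ss) → Failure ss
  inner : ∀ us z s vs → ss ≡ us ++ ones z ++ s ∷ vs → length ss < suc z + suc z → Failure ss

-- The bounds are doubled because the machine has no division.
record Found (ss : List ℕ) (p x y : ℕ) : Set where
  field
    big-p : Big ss p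
    big-x : Big ss x
    big-y : Big ss y
    p≤x   : p ≤ x
    near  : (x ∸ p) + (x ∸ p) < length ss
    far   : length ss ≤ (y ∸ p) + (y ∸ p)
    gap   : (y ∸ x) + (y ∸ x) ≤ length ss

failure-unsolvable : ∀ m {c ss} → length ss ≡ m + m → Failure ss → ¬ Solvable (expand c ss)
failure-unsolvable m {c} even (inner us z s vs refl short) (_ , sol) =
  <⇒≱ (halve-< {z} {m} 2z<2m) (≤-pred (halve-< {m} {suc z} (subst (_< suc z + suc z) even short)))
  where
  arith : ∀ z a b → suc (z + (b + a)) ≡ a + (z + suc b)
  arith = solve-∀
  size : length (us ++ ones z ++ s ∷ vs) ≡ length us + (z + suc (length vs))
  size = trans (length-++ us) (cong (length us +_)
    (trans (length-++ (ones z)) (cong (_+ suc (length vs)) (length-replicate z))))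
  2z<2m : z + z < m + m
  2z<2m = begin-strict
    z + z                                     ≤⟨ +-monoʳ-≤ z (inner-gap-bound {c} us z s vs sol) ⟩
    z + (length vs + length us)               <⟨ n<1+n _ ⟩
    suc (z + (length vs + length us))         ≡⟨ trans (arith z (length us) (length vs)) (sym size) ⟩
    length (us ++ ones z ++ s ∷ vs)           ≡⟨ even ⟩
    m + m                                     ∎
    where open ≤-Reasoning
failure-unsolvable m {c} even (outer p ts z refl nonempty short) (_ , sol) =
  <-irrefl refl (begin-strict
    m + m              ≡⟨ trans (sym size) (arith p (length ts) z) ⟩
    length ts + (z + p) ≤⟨ +-monoʳ-≤ (length ts) (outer-gap-bound {c} m p ts z size sol) ⟩
    length ts + (length ts ∸ 1) <⟨ +-mono-≤-< ts≤m (∸1-< (length ts) ts≤m 0<m) ⟩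
    m + m              ∎)
  where
  open ≤-Reasoning
  arith : ∀ p t z → p + (t + z) ≡ t + (z + p)
  arith = solve-∀
  size : p + (length ts + z) ≡ m + m
  size = begin-equality
    p + (length ts + z)
      ≡⟨ cong₂ (λ i j → i + (length ts + j)) (length-replicate p) (length-replicate z) ⟨
    length (ones p) + (length ts + length (ones z))
      ≡⟨ cong (length (ones p) +_) (length-++ ts) ⟨
    length (ones p) + length (ts ++ ones z)
      ≡⟨ length-++ (ones p) ⟨
    length (ones p ++ ts ++ ones z)
      ≡⟨ even ⟩
    m + m ∎
  0<m : 0 < m
  0<m = halve-< {0} {m} (≤-trans nonempty (≤-reflexive even))
  ts≤m : length ts ≤ m
  ts≤m = ≤-pred (halve-< {length ts} {suc m} (begin-strict
    length ts + length ts ≤⟨ short ⟩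
    suc (length (ones p ++ ts ++ ones z)) ≡⟨ cong suc even ⟩
    suc (m + m)           <⟨ n<1+n _ ⟩
    suc (suc (m + m))     ≡⟨ cong suc (+-suc m m) ⟨
    suc m + suc m         ∎))
  -- For empty `ts` the truncated `length ts ∸ 1` is zero, and it is below `m` because the list is
  -- nonempty.
  ∸1-< : ∀ a → a ≤ m → 0 < m → a ∸ 1 < m
  ∸1-< zero    _   0<m = 0<m
  ∸1-< (suc a) a<m _   = a<m

record Parameters (m p x y : ℕ) : Set where
  field
    k r i : ℕ
    half  : m ≡ p + k + suc r
    x≡    : x ≡ k + i
    y≡    : y ≡ k + k + (r + suc (p + p))
    p≤i   : p ≤ i
    i≤    : i ≤ r + suc (p + p)

-- Here `k = y − p − m`, `r = m − p − k − 1` and `i = x − k`. The first exists by `far`, the second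
-- by `y < 2m`; `gap` gives `p + k ≤ x` and so `p ≤ i`, and `near` bounds `i` from above.
parameters : ∀ {ss p x y} m → length ss ≡ m + m → Found ss p x y → Parameters m p x y
parameters {ss} {p} {x} {y} m even found
  with k , y≡ ← m≤n⇒∃[o]m+o≡n (halve-≤ {m} (subst (_≤ (y ∸ p) + (y ∸ p)) even (Found.far found)))
  = go
  where
  open Found found
  m≤y∸p : m ≤ y ∸ p
  m≤y∸p = halve-≤ (subst (_≤ (y ∸ p) + (y ∸ p)) even far)
  y∸x≤m : y ∸ x ≤ m
  y∸x≤m = halve-≤ (subst ((y ∸ x) + (y ∸ x) ≤_) even gap)
  x∸p<m : x ∸ p < m
  x∸p<m = halve-< (subst ((x ∸ p) + (x ∸ p) <_) even near)
  0<m : 0 < m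
  0<m = ≤-trans (s≤s z≤n) x∸p<m
  p≤y : p ≤ y
  -- For `y ≤ p` truncation would make `y ∸ p` zero, although it is at least `m`.
  p≤y = <⇒≤ (≰⇒> λ y≤p → <⇒≱ 0<m (≤-trans m≤y∸p (≤-reflexive (m≤n⇒m∸n≡0 y≤p))))
  y-eq : p + (m + k) ≡ y
  y-eq = trans (cong (p +_) y≡) (m+[n∸m]≡n p≤y)
  p+k<m : suc (p + k) ≤ m
  p+k<m = +-cancelˡ-< m (p + k) m (begin-strict
    m + (p + k) ≡⟨ arith m p k ⟩
    p + (m + k) ≡⟨ y-eq ⟩
    y           <⟨ big-length big-y ⟩
    length ss   ≡⟨ even ⟩
    m + m       ∎)
    where
    open ≤-Reasoning
    arith : ∀ m p k → m + (p + k) ≡ p + (m + k)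
    arith = solve-∀
  y≤x+m : y ≤ x + m
  y≤x+m = ≤-trans (m≤n+m∸n y x) (+-monoʳ-≤ x y∸x≤m)
  p+k≤x : p + k ≤ x
  p+k≤x = +-cancelʳ-≤ m (p + k) x (≤-trans (≤-reflexive (trans (arith m p k) y-eq)) y≤x+m)
    where
    arith : ∀ m p k → p + k + m ≡ p + (m + k)
    arith = solve-∀
  x<p+m : x < p + m
  x<p+m = begin-strict
    x           ≡⟨ m+[n∸m]≡n p≤x ⟨
    p + (x ∸ p) <⟨ +-monoʳ-< p x∸p<m ⟩
    p + m       ∎
    where open ≤-Reasoning
  go : Parameters m p x y
  go with m≤n⇒∃[o]m+o≡n p+k<m | m≤n⇒∃[o]m+o≡n p+k≤x
  ... | r , m≡ | o , x≡ = record
    { k = k ; r = r ; i = p + o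
    ; half = trans (sym m≡) (sym (+-suc (p + k) r))
    ; x≡ = trans (sym x≡) (arith₁ p k o)
    ; y≡ = trans (sym y-eq) (trans (cong (λ m → p + (m + k)) (sym m≡)) (arith₂ p k r))
    ; p≤i = m≤m+n p o
    ; i≤ = +-cancelˡ-≤ k _ _ (begin
        k + (p + o)           ≡⟨ trans (sym (arith₁ p k o)) x≡ ⟩
        x                     ≤⟨ <⇒≤ x<p+m ⟩
        p + m                 ≡⟨ cong (p +_) m≡ ⟨
        p + (suc (p + k) + r) ≡⟨ arith₃ p k r ⟩
        k + (r + suc (p + p)) ∎)
    }
    where
    open ≤-Reasoning
    arith₁ : ∀ p k o → p + k + o ≡ k + (p + o)
    arith₁ = solve-∀
    arith₂ : ∀ p k r → p + ((suc (p + k) + r) + k) ≡ k + k + (r + suc (p + p))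
    arith₂ = solve-∀
    arith₃ : ∀ p k r → p + (suc (p + k) + r) ≡ k + (r + suc (p + p))
    arith₃ = solve-∀

-- Verification of the scan

Registers : ℕ → Memory → ℕ → ℕ → ℕ → Set
Registers n m p x y =
  m #n ≡ n × m #p ≡ p × m #x ≡ x × m #i ≡ y × m #zero ≡ 0 × m #one ≡ 1

-- One verification serves both programs: `tail` is the code from address 35 on, `b` its time, and
-- the three continuations establish `Post` for each outcome.
module Scan (tail : Program) (ss : List ℕ) (ps : Positive ss) (b : ℕ) (Post : List ℕ → Set)
  (failed : Failure ss → Post (0 ∷ []))
  (found : ∀ {p x y m xs} → Found ss p x y → Registers (length ss) m p x y →
           Halts (scan ++ tail) ⟨ 35 , m , xs , [] ⟩ b Post)
  (empty : ss ≡ [] → ∀ {m xs} → m #n ≡ 0 → Halts (scan ++ tail) ⟨ 35 , m , xs , [] ⟩ b Post)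
  where

  n = length ss
  P = scan ++ tail

  rejects : ∀ {m xs b} → m #zero ≡ 0 → Failure ss → Halts P ⟨ 20 , m , xs , [] ⟩ (2 + b) Post
  rejects z f = advance refl refl (halted refl (subst (λ a → Post (a ∷ [])) (sym z) (failed f)))

  -- The longest round that continues the search sets a new `x` and takes 11 instructions. Five more
  -- cover the end of the input, or the excess of a last round that rejects after the gap test.
  searchBudget : ℕ → ℕ
  searchBudget l = l * 11 + (5 + b)

  within : ∀ k l → k ≤ 11 → ∀ {c} → Halts P c (k + searchBudget l) Post →
           Halts P c (searchBudget (suc l)) Post
  within k l k≤11 = weaken (+-monoˡ-≤ (searchBudget l) k≤11)

  reduced : List ℕ → List ℕ
  reduced = map (2 ⊓_)

  unread : ∀ us rest {l} → length us ≡ suc l → ss ≡ us ++ rest → n ∸ suc l ≡ length rest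
  unread us rest eq refl = trans (cong₂ _∸_ (length-++ us) (sym eq)) (m+n∸m≡n (length us) _)

  difference-positive : ∀ {k l d} → k ∸ l ≡ suc d → l < k
  difference-positive {k} {l} e = ≰⇒> λ k≤l → 0≢1+n (trans (sym (m≤n⇒m∸n≡0 k≤l)) e)

  ones-snoc : ∀ z {vs} → ones z ++ 1 ∷ vs ≡ ones (suc z) ++ vs
  ones-snoc zero    = refl
  ones-snoc (suc z) = cong (1 ∷_) (ones-snoc z)

  -- The loop invariant: `ts` are the groups from `p` to `x`, `z` single groups have been read
  -- since, and `#i` is the index of the group read last. If the input ends here, all groups outside
  -- `ts` are single, which is an outer failure.
  search-y : ∀ rest {p ts z x m} → ss ≡ (ones p ++ ts ++ ones z) ++ rest → p + length ts ≡ suc x →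
    Big ss p → Big ss x → p ≤ x → (x ∸ p) + (x ∸ p) < n → Registers n m p x (x + z) →
    Halts P ⟨ 17 , m , reduced rest , [] ⟩ (searchBudget (length rest)) Post
  search-y rest {p} {ts} {z} {x} {m} eq len bp bx p≤x near (hn , hp , hx , hi , h0 , h1) = body rest eq
    where
    y = suc (x + z)
    hi′ : m #i + m #one ≡ y
    hi′ = trans (cong₂ _+_ hi h1) (+-comm (x + z) 1)
    size : length (ones p ++ ts ++ ones z) ≡ y
    size = begin
      length (ones p ++ ts ++ ones z)              ≡⟨ length-++ (ones p) ⟩
      length (ones p) + length (ts ++ ones z)      ≡⟨ cong₂ _+_ (length-replicate p) (length-++ ts) ⟩
      p + (length ts + length (ones z))            ≡⟨ +-assoc p _ _ ⟨
      p + length ts + length (ones z)              ≡⟨ cong₂ _+_ len (length-replicate z) ⟩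
      y                                            ∎
      where open ≡-Reasoning
    remaining : ∀ rest → ss ≡ (ones p ++ ts ++ ones z) ++ rest → m #n ∸ (m #i + m #one) ≡ length rest
    remaining rest eq = trans (cong₂ _∸_ hn hi′) (unread (ones p ++ ts ++ ones z) rest size eq)
    far′ : (m #i + m #one ∸ m #p) + (m #i + m #one ∸ m #p) ≡ (y ∸ p) + (y ∸ p)
    far′ = cong (λ a → a + a) (cong₂ _∸_ hi′ hp)
    gap′ : (m #i + m #one ∸ m #x) + (m #i + m #one ∸ m #x) ≡ (y ∸ x) + (y ∸ x)
    gap′ = cong (λ a → a + a) (cong₂ _∸_ hi′ hx)
    body : ∀ rest → ss ≡ (ones p ++ ts ++ ones z) ++ rest →
           Halts P ⟨ 17 , m , reduced rest , [] ⟩ (searchBudget (length rest)) Post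
    body [] eq = steps 2 refl (jump-skipped refl (remaining [] eq)
      (rejects h0 (outer p ts z (trans eq (++-identityʳ _)) (≤-<-trans z≤n near) (begin
        length ts + length ts          ≡⟨ cong (λ l → l + l) ts≡ ⟩
        suc (x ∸ p) + suc (x ∸ p)      ≡⟨ cong suc (+-suc (x ∸ p) (x ∸ p)) ⟩
        suc (suc ((x ∸ p) + (x ∸ p)))  ≤⟨ s≤s near ⟩
        suc n                          ∎))))
      where
      open ≤-Reasoning
      ts≡ : length ts ≡ suc (x ∸ p)
      ts≡ = trans (sym (m+n∸m≡n p (length ts))) (trans (cong (_∸ p) len) (+-∸-assoc 1 p≤x))
    body (zero ∷ rest) eq with () ← All.head (All.++⁻ʳ (ones p ++ ts ++ ones z) (subst Positive eq ps))
    body (suc zero ∷ rest) eq = within 8 (length rest) (≤ᵇ⇒≤ 8 11 _) (steps 2 refl (jump-taken refl (remaining (1 ∷ rest) eq)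
      (steps 2 refl (jump-skipped refl (cong (1 ∸_) h1) (steps 2 refl
        (search-y rest {z = suc z} (trans eq longer) len bp bx p≤x near
                  (hn , hp , hx , trans hi′ (sym (+-suc x z)) , h0 , h1)))))))
      where
      open ≡-Reasoning
      longer : (ones p ++ ts ++ ones z) ++ 1 ∷ rest ≡ (ones p ++ ts ++ ones (suc z)) ++ rest
      longer = begin
        (ones p ++ ts ++ ones z) ++ 1 ∷ rest     ≡⟨ ++-assoc (ones p) _ _ ⟩
        ones p ++ (ts ++ ones z) ++ 1 ∷ rest     ≡⟨ cong (ones p ++_) (++-assoc ts _ _) ⟩
        ones p ++ ts ++ ones z ++ 1 ∷ rest       ≡⟨ cong (λ us → ones p ++ ts ++ us) (ones-snoc z) ⟩
        ones p ++ ts ++ ones (suc z) ++ rest     ≡⟨ cong (ones p ++_) (++-assoc ts _ _) ⟨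
        ones p ++ (ts ++ ones (suc z)) ++ rest   ≡⟨ ++-assoc (ones p) _ _ ⟨
        (ones p ++ ts ++ ones (suc z)) ++ rest   ∎
    body (suc (suc s) ∷ rest) eq = compareFar _ refl
      where
      by : Big ss y
      by = subst₂ Big (sym eq) size (big-++ (ones p ++ ts ++ ones z) (s≤s (s≤s z≤n)))
      x≤y : x ≤ y
      x≤y = m≤n⇒m≤1+n (m≤m+n x z)
      y∸x : y ∸ x ≡ suc z
      y∸x = trans (cong (_∸ x) (sym (+-suc x z))) (m+n∸m≡n x (suc z))
      regroup : (ones p ++ ts ++ ones z) ++ 2 + s ∷ rest ≡
                (ones p ++ (ts ++ ones z ++ 2 + s ∷ []) ++ []) ++ rest
      regroup = begin
        (ones p ++ ts ++ ones z) ++ 2 + s ∷ rest             ≡⟨ ++-assoc (ones p) _ _ ⟩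
        ones p ++ (ts ++ ones z) ++ 2 + s ∷ rest             ≡⟨ cong (ones p ++_) (++-assoc ts _ _) ⟩
        ones p ++ ts ++ ones z ++ 2 + s ∷ rest               ≡⟨ cong (λ us → ones p ++ ts ++ us) (++-assoc (ones z) _ _) ⟨
        ones p ++ ts ++ (ones z ++ 2 + s ∷ []) ++ rest       ≡⟨ cong (ones p ++_) (++-assoc ts _ _) ⟨
        ones p ++ (ts ++ ones z ++ 2 + s ∷ []) ++ rest       ≡⟨ ++-assoc (ones p) _ _ ⟨
        (ones p ++ ts ++ ones z ++ 2 + s ∷ []) ++ rest       ≡⟨ cong (λ us → (ones p ++ us) ++ rest) (++-identityʳ _) ⟨
        (ones p ++ (ts ++ ones z ++ 2 + s ∷ []) ++ []) ++ rest ∎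
        where open ≡-Reasoning
      len′ : p + length (ts ++ ones z ++ 2 + s ∷ []) ≡ suc y
      len′ = begin
        p + length (ts ++ ones z ++ 2 + s ∷ [])   ≡⟨ cong (p +_) (length-++ ts) ⟩
        p + (length ts + length (ones z ++ 2 + s ∷ []))
          ≡⟨ cong (λ l → p + (length ts + l)) (trans (length-++ (ones z)) (cong (_+ 1) (length-replicate z))) ⟩
        p + (length ts + (z + 1))                 ≡⟨ +-assoc p _ _ ⟨
        p + length ts + (z + 1)                   ≡⟨ cong₂ _+_ len (+-comm z 1) ⟩
        suc x + suc z                             ≡⟨ cong suc (+-suc x z) ⟩
        suc y                                     ∎
        where open ≡-Reasoning
      -- A positive value means that the big group just read is less than half the circle beyond `p`
      -- and becomes the new `x`; otherwise it is `y`.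
      compareFar : ∀ a → n ∸ ((y ∸ p) + (y ∸ p)) ≡ a →
                Halts P ⟨ 17 , m , 2 ∷ reduced rest , [] ⟩ (searchBudget (suc (length rest))) Post
      compareFar (suc a) e₁ = within 11 (length rest) ≤-refl
        (steps 2 refl (jump-taken refl (remaining (2 + s ∷ rest) eq)
        (steps 2 refl (jump-taken refl (cong (2 ∸_) h1)
        (steps 3 refl (jump-taken refl (trans (cong₂ _∸_ hn far′) e₁)
        (steps 1 refl
        (search-y rest {p} {ts ++ ones z ++ 2 + s ∷ []} {0} {y} (trans eq regroup) len′ bp by (≤-trans p≤x x≤y)
          (difference-positive e₁)
          (hn , hp , trans (cong₂ _+_ hi′ h0) (+-identityʳ y) , trans hi′ (sym (+-identityʳ y)) , h0 , h1)))))))))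
      compareFar zero e₁ = compareGap _ refl
        where
        -- A positive value means that `y − x` exceeds half the circle, so the single groups in
        -- between form an inner failure.
        compareGap : ∀ a → (y ∸ x) + (y ∸ x) ∸ n ≡ a →
                Halts P ⟨ 17 , m , 2 ∷ reduced rest , [] ⟩ (searchBudget (suc (length rest))) Post
        compareGap (suc a) e₂ = weaken (+-monoʳ-≤ 11 (m≤n+m (5 + b) (length rest * 11)))
          (steps 2 refl (jump-taken refl (remaining (2 + s ∷ rest) eq)
          (steps 2 refl (jump-taken refl (cong (2 ∸_) h1)
          (steps 3 refl (jump-skipped refl (trans (cong₂ _∸_ hn far′) e₁)
          (steps 3 refl (jump-taken refl (trans (cong₂ _∸_ gap′ hn) e₂)
          (rejects h0 (inner (ones p ++ ts) z (2 + s) rest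
            (trans eq (trans (cong (_++ 2 + s ∷ rest) (sym (++-assoc (ones p) ts _))) (++-assoc (ones p ++ ts) _ _)))
            (subst (λ l → n < l + l) y∸x (difference-positive e₂))))))))))))
        compareGap zero e₂ = weaken (≤-trans (m≤n+m (14 + b) 2) (+-monoʳ-≤ 11 (m≤n+m (5 + b) (length rest * 11))))
          (steps 2 refl (jump-taken refl (remaining (2 + s ∷ rest) eq)
          (steps 2 refl (jump-taken refl (cong (2 ∸_) h1)
          (steps 3 refl (jump-skipped refl (trans (cong₂ _∸_ hn far′) e₁)
          (steps 3 refl (jump-skipped refl (trans (cong₂ _∸_ gap′ hn) e₂)
          (found (record { big-p = bp ; big-x = bx ; big-y = by ; p≤x = p≤x ; near = near
                         ; far = m∸n≡0⇒m≤n e₁ ; gap = m∸n≡0⇒m≤n e₂ })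
            (hn , hp , hx , hi′ , h0 , h1))))))))))

  search-p : ∀ rest {i m} → ss ≡ ones i ++ rest → 0 < n → m #n ≡ n → m #i ≡ i → m #zero ≡ 0 → m #one ≡ 1 →
             Halts P ⟨ 5 , m , reduced rest , [] ⟩ (searchBudget (length rest)) Post
  search-p rest {i} {m} eq 0<n hn hi h0 h1 = body rest eq
    where
    remaining : ∀ rest → ss ≡ ones i ++ rest → m #n ∸ m #i ≡ length rest
    remaining rest refl = trans (cong₂ _∸_ hn hi)
      (trans (cong (_∸ i) (trans (length-++ (ones i)) (cong (_+ length rest) (length-replicate i)))) (m+n∸m≡n i _))
    body : ∀ rest → ss ≡ ones i ++ rest → Halts P ⟨ 5 , m , reduced rest , [] ⟩ (searchBudget (length rest)) Post
    -- Without a big group the whole list is the outer run.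
    body [] eq = steps 1 refl (jump-skipped refl (remaining [] eq)
      (advance refl refl (halted refl (subst (λ a → Post (a ∷ [])) (sym h0)
        (failed (outer i [] 0 eq 0<n z≤n))))))
    body (zero ∷ rest) eq with () ← All.head (All.++⁻ʳ (ones i) (subst Positive eq ps))
    body (suc zero ∷ rest) eq = within 8 (length rest) (≤ᵇ⇒≤ 8 11 _)
      (steps 1 refl (jump-taken refl (remaining (1 ∷ rest) eq)
      (steps 2 refl (jump-skipped refl (cong (1 ∸_) h1)
      (steps 3 refl (search-p rest {suc i} (trans eq (ones-snoc i)) 0<n hn (trans (cong₂ _+_ hi h1) (+-comm i 1)) h0 h1))))))
    -- The first big group is `p` and also the first candidate for `x`.
    body (suc (suc s) ∷ rest) eq = within 7 (length rest) (≤ᵇ⇒≤ 7 11 _)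
      (steps 1 refl (jump-taken refl (remaining (2 + s ∷ rest) eq)
      (steps 2 refl (jump-taken refl (cong (2 ∸_) h1)
      (steps 2 refl (search-y rest {i} {2 + s ∷ []} {0} {i} (trans eq (sym (++-assoc (ones i) _ rest))) (+-comm i 1)
        big big ≤-refl (subst (λ d → d + d < n) (sym (n∸n≡0 i)) 0<n)
        (hn , hi′ , hi′ , trans hi (sym (+-identityʳ i)) , h0 , h1)))))))
      where
      big : Big ss i
      big = subst₂ Big (sym eq) (length-replicate i) (big-++ (ones i) (s≤s (s≤s z≤n)))
      hi′ : m #i + m #zero ≡ i
      hi′ = trans (cong₂ _+_ hi h0) (+-identityʳ i)

  scan-halts : Halts P (initial (n ∷ reduced ss)) (5 + searchBudget n) Post
  scan-halts = start ss refl
    where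
    start : ∀ ts → ss ≡ ts → Halts P (initial (n ∷ reduced ss)) (5 + searchBudget n) Post
    start [] eq = weaken (+-monoʳ-≤ 5 (≤-trans (m≤n+m b 5) (m≤n+m (5 + b) (n * 11))))
      (steps 2 refl (jump-skipped refl (cong length eq) (steps 2 refl (empty eq (cong length eq)))))
    start (s ∷ ts) eq = weaken (m≤n+m _ 2)
      (steps 2 refl (jump-taken refl (cong length eq)
        (search-p ss {0} refl (subst (0 <_) (sym (cong length eq)) (s≤s z≤n)) refl refl refl refl)))

-- The decision program and the solution program

found-solution : ∀ {c ss p x y} m → Positive ss → length ss ≡ m + m → (f : Found ss p x y) →
  (q : Parameters m p x y) (let open Parameters q) → Solution (expand c ss) (clicks p k r i)
found-solution {c} {ss} {p} m ps even f q =
  clicks-solve c p k r i ps (trans even (cong (λ h → h + h) half)) big-p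
    (subst (Big ss) x≡ big-x) (subst (Big ss) y≡ big-y) p≤i i≤
  where
  open Parameters q
  open Found f

decider-halts : ∀ m {c ss} → Positive ss → length ss ≡ m + m →
  Halts decider (initial (length ss ∷ map (2 ⊓_) ss)) (length ss * 11 + 13) (Decides (Solvable (expand c ss)))
decider-halts m {c} {ss} ps even = weaken (≤-reflexive (arith (length ss))) S.scan-halts
  where
  arith : ∀ n → 5 + (n * 11 + 8) ≡ n * 11 + 13
  arith = solve-∀
  module S = Scan (const #t 1 ∷ print #t ∷ halt ∷ []) ss ps 3 (Decides (Solvable (expand c ss)))
    (λ f → reject (failure-unsolvable m even f))
    (λ f _ → steps 2 refl (halted refl (accept (_ , found-solution m ps even f (parameters m even f)))))
    (λ eq _ → steps 2 refl (halted refl (accept ([] , subst (λ ss → Solution (expand c ss) []) (sym eq) []))))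

solver-halts : ∀ m {c ss} → Positive ss → length ss ≡ m + m → Solvable (expand c ss) →
  Halts solver (initial (length ss ∷ map (2 ⊓_) ss)) (length ss * 18 + 40) (Solution (expand c ss))
solver-halts m {c} {ss} ps even solvable = weaken (≤-reflexive (arith n)) S.scan-halts
  where
  n = length ss
  arith : ∀ n → 5 + (n * 11 + (5 + (30 + n * 7))) ≡ n * 18 + 40
  arith = solve-∀

  Kept : ℕ → ℕ → Memory → Set
  Kept p y m = m #n ≡ n × m #p ≡ p × m #i ≡ y × m #d ≡ p + p × m #zero ≡ 0 × m #one ≡ 1

  print-clicks : ∀ {p x y m′ xs} → Found ss p x y → Registers n m′ p x y →
    Halts solver ⟨ 35 , m′ , xs , [] ⟩ (30 + n * 7) (Solution (expand c ss))
  print-clicks {p} {x} {y} {m′} f (hn , hp , hx , hi , h0 , h1) =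
    -- The loops print `k + (r + 1) + (p + 1) = m + 1` clicks in seven instructions each; the seven
    -- for the extra click are among the 30.
    weaken (≤-trans (≤-reflexive (total p k r)) (+-monoʳ-≤ 30 (*-monoˡ-≤ 7 m≤n)))
    (jump-taken refl (trans hn (sym (suc-pred n {{>-nonZero (≤-<-trans z≤n (big-length big-p))}})))
    (steps 5 refl
    (countdown-loop 42 _ refl (Kept p y) one (λ _ _ inv → inv) k
      (hn , hp , hi , cong₂ _+_ hp hp , h0 , h1)
      (trans (cong₂ _+_ hx h0) (trans (+-identityʳ x) x≡))
      (trans (cong₂ (λ a b → (a + a) ∸ b ∸ m′ #n) hi (cong₂ _+_ hp hp)) (trans (cong ((y + y) ∸ (p + p) ∸_) hn) count₁))
    λ (hn , hp , hi , hd , h0 , h1) →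
    steps 4 refl
    (countdown-loop 55 _ refl (Kept p y) one (λ _ _ inv → inv) (suc r)
      (hn , hp , hi , hd , h0 , h1)
      (trans (cong₂ _∸_ (cong₂ _+_ hn hd) hi) start₂)
      (cong (λ a → a + a) (trans (cong₂ _∸_ (trans (cong₂ _∸_ (cong₂ _+_ hn hd) hi) start₂) hd) count₂))
    λ (hn , hp , hi , hd , h0 , h1) →
    steps 3 refl
    (countdown-loop 67 _ refl (Kept p y) one (λ _ _ inv → inv) (suc p)
      (hn , hp , hi , hd , h0 , h1)
      (trans (cong₂ _+_ hp h0) (+-identityʳ p))
      (trans (cong₂ (λ a b → a + b + b) hd h1) (count₃ p))
    λ _ → halted refl
      (subst (Solution (expand c ss)) (sym (++-assoc (countdown k (k + i)) _ _)) (found-solution m ps even f q)))))))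
    where
    q = parameters m even f
    open Parameters q
    open Found f using (big-p)
    one : ∀ m → Kept p y m → m #one ≡ 1
    one _ (_ , _ , _ , _ , _ , h1) = h1
    size : n ≡ (p + k + suc r) + (p + k + suc r)
    size = trans even (cong (λ h → h + h) half)
    m≤n : p + k + suc r ≤ n
    m≤n = ≤-trans (m≤m+n _ _) (≤-reflexive (sym size))
    total : ∀ p k r → 1 + (5 + (k * 7 + (3 + (4 + (suc r * 7 + (3 + (3 + (suc p * 7 + (3 + 1))))))))) ≡ 30 + (p + k + suc r) * 7
    total = solve-∀
    count₁ : (y + y) ∸ (p + p) ∸ n ≡ k + k
    count₁ = begin
      (y + y) ∸ (p + p) ∸ n ≡⟨ ∸-+-assoc (y + y) (p + p) n ⟩
      (y + y) ∸ (p + p + n) ≡⟨ cong₂ _∸_ (trans (cong (λ y → y + y) y≡) (rearrange p k r)) (cong (p + p +_) size) ⟩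
      s + (k + k) ∸ s       ≡⟨ m+n∸m≡n s (k + k) ⟩
      k + k                 ∎
      where
      open ≡-Reasoning
      s = p + p + ((p + k + suc r) + (p + k + suc r))
      rearrange : ∀ p k r → (k + k + (r + suc (p + p))) + (k + k + (r + suc (p + p))) ≡
                            p + p + ((p + k + suc r) + (p + k + suc r)) + (k + k)
      rearrange = solve-∀
    -- This is `y − 2k`, the index of `y` after the merges; as `2(y − k) = n + 2p`, it can be
    -- computed from `n`, `p` and `y` alone.
    start₂ : n + (p + p) ∸ y ≡ r + suc (p + p)
    start₂ = begin
      n + (p + p) ∸ y                  ≡⟨ cong₂ _∸_ (trans (cong (_+ (p + p)) size) (rearrange p k r)) y≡ ⟩
      s + (r + suc (p + p)) ∸ s        ≡⟨ m+n∸m≡n s _ ⟩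
      r + suc (p + p)                  ∎
      where
      open ≡-Reasoning
      s = k + k + (r + suc (p + p))
      rearrange : ∀ p k r → (p + k + suc r) + (p + k + suc r) + (p + p) ≡
                            k + k + (r + suc (p + p)) + (r + suc (p + p))
      rearrange = solve-∀
    count₂ : r + suc (p + p) ∸ (p + p) ≡ suc r
    count₂ = trans (cong (_∸ (p + p)) (+-suc r (p + p))) (m+n∸n≡m (suc r) (p + p))
    count₃ : ∀ p → p + p + 1 + 1 ≡ suc p + suc p
    count₃ = solve-∀

  module S = Scan _ ss ps (30 + n * 7) (Solution (expand c ss))
    (λ f → contradiction solvable (failure-unsolvable m even f))
    print-clicks
    (λ eq h → jump-skipped refl h (halted refl (subst (λ ss → Solution (expand c ss) []) (sym eq) [])))

linear-∈O : ∀ a d → (λ n → n * a + d) ∈O (λ n → n)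
-- From 1 on, `d ≤ d * n` absorbs the additive constant.
linear-∈O a d = a + d , 1 , λ { n@(suc _) _ → begin
  n * a + d     ≤⟨ +-mono-≤ (≤-reflexive (*-comm n a)) (m≤m*n d n) ⟩
  a * n + d * n ≡⟨ *-distribʳ-+ n a d ⟨
  (a + d) * n   ∎ }
  where open ≤-Reasoning

on-expansions : ∀ {P} (T : ℕ → ℕ) {Post : Puzzle → List ℕ → Set} (Pre : Puzzle → Set) →
  (∀ m {c ss} → Positive ss → length ss ≡ m + m → Pre (expand c ss) →
    Halts P (initial (length ss ∷ map (2 ⊓_) ss)) (T (length ss)) (Post (expand c ss))) →
  ∀ n → 2 ∣ n → ∀ w → numGroups w ≡ n → Pre w → HaltsWithin P (encode w) (T n) (Post w)
on-expansions {P} T {Post} Pre h n (divides m n≡) w refl pre with as-expansion w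
... | c , eq , _ , ps =
  subst₂ (λ k w′ → Halts P (initial (k ∷ map (2 ⊓_) (groupSizes w))) (T k) (Post w′)) size (sym eq)
    (h m ps (trans size (trans n≡ (double m))) (subst Pre eq pre))
  where
  size : length (groupSizes w) ≡ numGroups w
  size = length-map proj₂ (groups w)
  double : ∀ m → m * 2 ≡ m + m
  double = solve-∀

corollary13 : (∃[ P ] ∃[ T ] (T ∈O (λ n → n) ×
    (∀ (n : ℕ) → 2 ∣ n → ∀ (w : Puzzle) → numGroups w ≡ n →
    HaltsWithin P (encode w) (T n) (Decides (Solvable w)))))
    ×
    (∃[ Q ] ∃[ T ] (T ∈O (λ n → n) ×
    (∀ (n : ℕ) → 2 ∣ n → ∀ (w : Puzzle) → numGroups w ≡ n → Solvable w →
    HaltsWithin Q (encode w) (T n) (λ is → Solution w is))))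
corollary13 =
  (decider , _ , linear-∈O 11 13 , λ n even w eq →
    on-expansions (λ n → n * 11 + 13) {λ w → Decides (Solvable w)} (λ _ → ⊤)
      (λ m ps even _ → decider-halts m ps even) n even w eq tt) ,
  (solver , _ , linear-∈O 18 40 ,
    on-expansions (λ n → n * 18 + 40) {Solution} Solvable solver-halts)
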